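{- The following two statements are equivalent. (i) Almost all odd numbers can be represented as the sum of a squarefree number and a power of $2$. (ii) There do not exist an integer $m\geqslant 1$, pairwise distinct odd primes $p_1,\ldots,p_m$, and integers $a_1,\ldots,a_m$ such that the residue classes $a_j\pmod{\omega(p_j)}$, $1\leqslant j\leqslant m$, cover $\mathbb{Z}$.
   Context: For an odd prime $p$, $\omega(p)=\operatorname{ord}_{p^2}(2)$ denotes the multiplicative order of $2$ in $(\mathbb{Z}/p^2\mathbb{Z})^\ast$. "Almost all odd numbers" have a property means that the number of odd integers $n\in[1,X]$ without the property is $o(X)$ as $X\to\infty$. A squarefree number is a positive integer not divisible by the square of any prime, and a power of $2$ is a number $2^k$ with $k\geqslant0$ an integer. Residue classes cover $\mathbb{Z}$ if every integer lies in at least one of them. -}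

module Defs where

open import Data.Fin.Base using (Fin; toℕ)
open import Data.Fin.Properties using (pigeonhole; toℕ-fromℕ<)
open import Data.Integer.Base as ℤ using (ℤ; +_; 1ℤ; ∣_∣)
import Data.Integer.Divisibility as ℤ
open import Data.List.Base using (List; applyUpTo; filter; length)
open import Data.Nat.Base
open import Data.Nat.Coprimality as Coprime using (Coprime; coprime-divisor)
open import Data.Nat.Divisibility
open import Data.Nat.DivMod using (_%_; _/_; _mod_; m%n<n; m≡m%n+[m/n]*n)
open import Data.Nat.Primality using (Prime; prime?; prime⇒nonZero)
open import Data.Nat.Properties
open import Data.Product.Base using (Σ-syntax; ∃; ∃-syntax; _×_; _,_; proj₁; proj₂)
open import Data.Rational.Base as ℚ using (ℚ; 0ℚ)
open import Data.Sum.Base using (_⊎_; inj₁; inj₂; [_,_]′)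
open import Relation.Binary.PropositionalEquality
open import Relation.Nullary.Decidable using (yes; no; ¬?; _×-dec_; map′)
open import Relation.Nullary.Negation using (¬_; contradiction)
open import Relation.Unary using (Pred; Decidable)
open import Level using (0ℓ)

Odd : Pred ℕ 0ℓ
Odd n = ¬ 2 ∣ n

odd? : Decidable Odd
odd? n = ¬? (2 ∣? n)

SquareFree : Pred ℕ 0ℓ
SquareFree n = 0 < n × (∀ p → Prime p → ¬ p * p ∣ n)

IsSquareFreePlusPowerOf2 : Pred ℕ 0ℓ
IsSquareFreePlusPowerOf2 n = ∃[ s ] ∃[ k ] SquareFree s × n ≡ s + 2 ^ k

private
  squareFree? : Decidable SquareFree
  squareFree? zero = no λ ()
  squareFree? n@(suc _) = map′ to from
    (allUpTo? {P = λ p → ¬ (Prime p × p * p ∣ n)}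
      (λ p → ¬? (prime? p ×-dec (p * p ∣? n))) (suc n))
    where
    Bounded = ∀ {p} → p < suc n → ¬ (Prime p × p * p ∣ n)

    to : Bounded → SquareFree n
    to h = z<s , λ p pp p²∣n →
      let instance _ = prime⇒nonZero pp in
      h (s≤s (≤-trans (m≤m*n p p) (∣⇒≤ p²∣n))) (pp , p²∣n)

    from : SquareFree n → Bounded
    from (_ , h) _ (pp , p²∣n) = h _ pp p²∣n

  n<2^n : ∀ n → n < 2 ^ n
  n<2^n zero = z<s
  n<2^n (suc n) = begin-strict
    suc n               ≤⟨ n<2^n n ⟩
    2 ^ n               <⟨ m<m+n (2 ^ n) (m^n>0 2 n) ⟩
    2 ^ n + 2 ^ n       ≡⟨ cong (λ r → 2 ^ n + r) (+-identityʳ (2 ^ n)) ⟨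
    2 ^ suc n           ∎
    where open ≤-Reasoning

isSquareFreePlusPowerOf2? : Decidable IsSquareFreePlusPowerOf2
isSquareFreePlusPowerOf2? n = map′
  (λ (s , _ , k , _ , sf , eq) → s , k , sf , eq)
  (λ (s , k , sf , eq) →
      s , s≤s (≤-trans (m≤m+n s (2 ^ k)) (≤-reflexive (sym eq)))
    , k , ≤-trans (n<2^n k) (≤-trans (m≤n+m (2 ^ k) s) (≤-trans (≤-reflexive (sym eq)) (n≤1+n n)))
    , sf , eq)
  (anyUpTo? (λ s → anyUpTo? (λ k → squareFree? s ×-dec (n ≟ s + 2 ^ k)) (suc n)) (suc n))

module _ {P : Pred ℕ 0ℓ} (P? : Decidable P) where

  oddExceptions : ℕ → List ℕ
  oddExceptions X = filter (λ n → odd? n ×-dec ¬? (P? n)) (applyUpTo suc X)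

  -- The number of odd n ∈ [1,X] failing P is o(X); since it only depends on
  -- ⌊X⌋, X ranges over ℕ.
  AlmostAllOdd : Set
  AlmostAllOdd = ∀ (ε : ℚ) → 0ℚ ℚ.< ε →
    ∃[ N ] ∀ X → N ≤ X →
      + length (oddExceptions X) ℚ./ 1 ℚ.≤ ε ℚ.* (+ X ℚ./ 1)

infix 4 _≡_[mod_]

_≡_[mod_] : ℤ → ℤ → ℕ → Set
x ≡ y [mod n ] = + n ℤ.∣ x ℤ.- y

record IsOrder (a n d : ℕ) : Set where
  field
    positive : 0 < d
    power≡1  : + (a ^ d) ≡ 1ℤ [mod n ]
    minimal  : ∀ {k} → 0 < k → + (a ^ k) ≡ 1ℤ [mod n ] → d ≤ k

private
  least : ∀ {P : Pred ℕ 0ℓ} → Decidable P → ∃ P →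
          ∃[ d ] P d × (∀ {k} → P k → d ≤ k)
  least {P} P? (n , pn) = [ (λ r → r) , (λ h → contradiction pn (h (n<1+n n))) ]′ (go (suc n))
    where
    go : ∀ b → (∃[ d ] P d × (∀ {k} → P k → d ≤ k)) ⊎ (∀ {k} → k < b → ¬ P k)
    go zero = inj₂ λ ()
    go (suc b) with go b | P? b
    ... | inj₁ r | _      = inj₁ r
    ... | inj₂ h | yes pb = inj₁ (b , pb , λ pk → ≮⇒≥ λ k<b → h k<b pk)
    ... | inj₂ h | no ¬pb = inj₂ λ {k} k<1+b pk →
      [ (λ k<b → h k<b pk) , (λ { refl → ¬pb pk }) ]′ (m≤n⇒m<n∨m≡n (s≤s⁻¹ k<1+b))

  %≡⇒∣∸ : ∀ x y n .{{_ : NonZero n}} → x % n ≡ y % n → n ∣ y ∸ x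
  %≡⇒∣∸ x y n eq = divides (y / n ∸ x / n) (begin
    y ∸ x                                          ≡⟨ cong₂ _∸_ (m≡m%n+[m/n]*n y n) (m≡m%n+[m/n]*n x n) ⟩
    (y % n + y / n * n) ∸ (x % n + x / n * n)      ≡⟨ cong (λ r → (y % n + y / n * n) ∸ (r + x / n * n)) eq ⟩
    (y % n + y / n * n) ∸ (y % n + x / n * n)      ≡⟨ [m+n]∸[m+o]≡n∸o (y % n) _ _ ⟩
    y / n * n ∸ x / n * n                          ≡⟨ *-distribʳ-∸ n (y / n) (x / n) ⟨
    (y / n ∸ x / n) * n                            ∎)
    where open ≡-Reasoning

  coprime-^-divisor : ∀ {a n} → Coprime a n → ∀ i {m} → n ∣ a ^ i * m → n ∣ m
  coprime-^-divisor {n = n} c zero {m} h = subst (n ∣_) (*-identityˡ m) h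
  coprime-^-divisor {a} {n} c (suc i) {m} h =
    coprime-^-divisor c i (coprime-divisor (Coprime.sym c) (subst (n ∣_) (*-assoc a (a ^ i) m) h))

  ∣∸1⇒≡1 : ∀ {x n} → 0 < x → n ∣ x ∸ 1 → + x ≡ 1ℤ [mod n ]
  ∣∸1⇒≡1 {suc x} _ h = h

  coprime-0 : ∀ {n} → Coprime 0 n → n ≡ 1
  coprime-0 {n} c = c (n ∣0 , ∣-refl)

  ≡1-exists : ∀ a n .{{_ : NonZero n}} → Coprime a n →
              ∃[ d ] 0 < d × + (a ^ d) ≡ 1ℤ [mod n ]
  ≡1-exists zero n c rewrite coprime-0 c = 1 , z<s , 1∣ _
  ≡1-exists a@(suc _) n c
    with i , j , i<j , eq ← pigeonhole (n<1+n n) (λ (i : Fin (suc n)) → (a ^ toℕ i) mod n)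
    = toℕ j ∸ toℕ i , m<n⇒0<n∸m i<j
    , ∣∸1⇒≡1 (m^n>0 a (toℕ j ∸ toℕ i))
        (coprime-^-divisor c (toℕ i) (subst (n ∣_) factor (%≡⇒∣∸ _ _ n %-eq)))
    where
    %-eq : a ^ toℕ i % n ≡ a ^ toℕ j % n
    %-eq = trans (sym (toℕ-fromℕ< (m%n<n (a ^ toℕ i) n)))
             (trans (cong toℕ eq) (toℕ-fromℕ< (m%n<n (a ^ toℕ j) n)))

    factor : a ^ toℕ j ∸ a ^ toℕ i ≡ a ^ toℕ i * (a ^ (toℕ j ∸ toℕ i) ∸ 1)
    factor = sym (begin
      a ^ toℕ i * (a ^ (toℕ j ∸ toℕ i) ∸ 1)
        ≡⟨ *-distribˡ-∸ (a ^ toℕ i) (a ^ (toℕ j ∸ toℕ i)) 1 ⟩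
      a ^ toℕ i * a ^ (toℕ j ∸ toℕ i) ∸ a ^ toℕ i * 1
        ≡⟨ cong₂ _∸_ (^-distribˡ-+-* a (toℕ i) (toℕ j ∸ toℕ i)) (sym (*-identityʳ (a ^ toℕ i))) ⟨
      a ^ (toℕ i + (toℕ j ∸ toℕ i)) ∸ a ^ toℕ i
        ≡⟨ cong (λ e → a ^ e ∸ a ^ toℕ i) (m+[n∸m]≡n (<⇒≤ i<j)) ⟩
      a ^ toℕ j ∸ a ^ toℕ i ∎)
      where open ≡-Reasoning

order : ∀ a n .{{_ : NonZero n}} → Coprime a n → ∃ (IsOrder a n)
order a n c with d , (0<d , a^d≡1) , min ←
  least (λ d → (0 <? d) ×-dec (n ∣? ∣ + (a ^ d) ℤ.- 1ℤ ∣)) (≡1-exists a n c)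
  = d , record { positive = 0<d ; power≡1 = a^d≡1 ; minimal = λ 0<k h → min (0<k , h) }

OddPrime : Pred ℕ 0ℓ
OddPrime p = Prime p × Odd p

private
  2-coprime : ∀ {n} → Odd n → Coprime 2 n
  2-coprime odd {zero} (0∣2 , _) with () ← 0∣⇒≡0 0∣2
  2-coprime odd {1} _ = refl
  2-coprime odd {2} (_ , 2∣n) = contradiction 2∣n odd
  2-coprime odd {suc (suc (suc _))} (d∣2 , _) with s≤s (s≤s ()) ← ∣⇒≤ d∣2

  odd-square : ∀ {p} → Odd p → Odd (p * p)
  odd-square {p} odd 2∣p² = odd (coprime-divisor (2-coprime odd) 2∣p²)

-- The value does not depend on the proof argument, since IsOrder determines d.
ω : ∀ p → OddPrime p → ℕ
ω p (isPrime , odd) = proj₁ (order 2 (p * p) (2-coprime (odd-square odd)))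
  where instance
    _ = prime⇒nonZero isPrime
    _ = m*n≢0 p p

Covers : ∀ {m} → (a : Fin m → ℤ) (n : Fin m → ℕ) → Set
Covers a n = ∀ x → ∃[ j ] x ≡ a j [mod n j ]

CoveringByOrders : Set
CoveringByOrders =
  ∃[ m ] 1 ≤ m ×
  Σ[ p ∈ (Fin m → ℕ) ] Σ[ oddPrime ∈ (∀ j → OddPrime (p j)) ]
    (∀ i j → i ≢ j → p i ≢ p j) ×
    (Σ[ a ∈ (Fin m → ℤ) ] Covers a (λ j → ω (p j) (oddPrime j)))

{-# OPTIONS --safe #-}

-- A covering by classes a_j (mod ω(p_j)) yields, by the Chinese remainder
-- theorem, a class of odd n ≡ 2^a_j (mod p_j²) for all j; whatever k is, some
-- p_j² divides n - 2^k, so the whole class, of positive density, is exceptional.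
--
-- Conversely, fix y and let M = (y!)². As the classes attached to the odd primes
-- p ≤ y do not cover ℤ, every n has an exponent k ≥ 1, bounded in terms of y and
-- depending only on n mod M, such that p² ∤ n - 2^k for all these p. If n is odd,
-- large and exceptional, then p² ∣ n - 2^k for some prime p > y. Since k is fixed
-- on each class modulo M, which is coprime to p, at most X/p² + M of the n ≤ X
-- satisfy this for a given p; summing over y < p ≤ √X bounds the number of
-- exceptions by X/y + M √X + O_y(1).

module Submission where

open import Defs
open import Function.Bundles using (_⇔_)
open import Relation.Nullary.Negation using (¬_)

open import Data.Fin.Base using (Fin; zero; suc; fromℕ<; combine)
import Data.Fin.Properties as Fin
open import Data.Integer.Base as ℤ using (ℤ; +_; +[1+_]; 1ℤ; ∣_∣)
import Data.Integer.DivMod as ℤ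
import Data.Integer.Divisibility.Signed as ℤ
import Data.Integer.Properties as ℤ
import Data.Integer.Tactic.RingSolver as ℤ
open import Data.List.Base using (List; []; length; lookup; concat; filter; upTo; applyUpTo; applyDownFrom; _++_)
open import Data.List.Membership.Propositional using (_∈_)
open import Data.List.Membership.Propositional.Properties
open import Data.List.Properties using (length-applyUpTo; length-upTo; length-++)
open import Data.List.Relation.Binary.Subset.Propositional using (_⊆_)
import Data.List.Relation.Unary.All as All
open import Data.List.Relation.Unary.AllPairs using (_∷_)
import Data.List.Relation.Unary.Any as Any
open import Data.List.Relation.Unary.Any.Properties using (lookup-index)
open import Data.List.Relation.Unary.Unique.Propositional using (Unique)
import Data.List.Relation.Unary.Unique.Propositional.Properties as Unique
open import Data.Nat.Base
open import Data.Nat.Coprimality as Coprime using (Coprime; coprime-divisor; coprime-Bézout)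
open import Data.Nat.DivMod
open import Data.Nat.Divisibility
open import Data.Nat.GCD using (module Bézout)
open import Data.Nat.Primality
open import Data.Nat.Properties
open import Data.Nat.Tactic.RingSolver using (solve-∀)
open import Data.Product.Base using (∃-syntax; _×_; _,_; proj₁; proj₂)
open import Data.Rational.Base as ℚ using (mkℚ; toℚᵘ; fromℚᵘ)
import Data.Rational.Properties as ℚ
open import Data.Rational.Unnormalised.Base as ℚᵘ using (mkℚᵘ; _≃_)
import Data.Rational.Unnormalised.Properties as ℚᵘ
open import Data.Sum.Base using (_⊎_; inj₁; inj₂; [_,_]′)
open import Data.Vec.Functional using (foldr)
open import Function.Base using (_∘_)
open import Function.Bundles using (mk⇔; Equivalence)
open import Level using (0ℓ)
open import Relation.Binary.PropositionalEquality
open import Relation.Nullary.Decidable using (Dec; yes; no; ¬?; _×-dec_; from-yes)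
open import Relation.Nullary.Negation using (contradiction)
open import Relation.Unary using (Pred; Decidable)

-- Congruences and orders

≡-mod-intro : ∀ x y {n} q → x ℤ.- y ≡ q ℤ.* + n → x ≡ y [mod n ]
≡-mod-intro _ _ q eq = ℤ.∣⇒∣ᵤ (ℤ.divides q eq)

≡-mod-elim : ∀ x y {n} → x ≡ y [mod n ] → ∃[ q ] x ℤ.- y ≡ q ℤ.* + n
≡-mod-elim _ _ h with ℤ.divides q eq ← ℤ.∣ᵤ⇒∣ h = q , eq

≡-mod-sym : ∀ x y {n} → x ≡ y [mod n ] → y ≡ x [mod n ]
≡-mod-sym x y {n} h = subst (n ∣_) (ℤ.∣i-j∣≡∣j-i∣ x y) h

≡-mod-trans : ∀ x y z {n} → x ≡ y [mod n ] → y ≡ z [mod n ] → x ≡ z [mod n ]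
≡-mod-trans x y z {n} h k = ℤ.∣⇒∣ᵤ
  (subst (+ n ℤ.∣_) (telescope x y z) (ℤ.∣m∣n⇒∣m+n (ℤ.∣ᵤ⇒∣ {+ n} {x ℤ.- y} h) (ℤ.∣ᵤ⇒∣ {+ n} {y ℤ.- z} k)))
  where
  telescope : ∀ x y z → (x ℤ.- y) ℤ.+ (y ℤ.- z) ≡ x ℤ.- z
  telescope = ℤ.solve-∀

∣-∣≡∸ : ∀ {m n} → n ≤ m → ∣ + m ℤ.- + n ∣ ≡ m ∸ n
∣-∣≡∸ {m} {n} n≤m = cong ∣_∣ (trans (ℤ.m-n≡m⊖n m n) (ℤ.⊖-≥ n≤m))

∣∸⇒≡-mod : ∀ {m n d} → n ≤ m → d ∣ m ∸ n → + m ≡ + n [mod d ]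
∣∸⇒≡-mod {d = d} n≤m = subst (d ∣_) (sym (∣-∣≡∸ n≤m))

≡-mod⇒∣∸ : ∀ {m n d} → n ≤ m → + m ≡ + n [mod d ] → d ∣ m ∸ n
≡-mod⇒∣∸ {d = d} n≤m = subst (d ∣_) (∣-∣≡∸ n≤m)

n≡n%d : ∀ n d .{{_ : NonZero d}} → + n ≡ + (n % d) [mod d ]
n≡n%d n d = ∣∸⇒≡-mod (m%n≤m n d) (subst (d ∣_) eq (n∣m*n (n / d)))
  where
  eq : n / d * d ≡ n ∸ n % d
  eq = trans (sym (m+n∸m≡n (n % d) _)) (cong (_∸ n % d) (sym (m≡m%n+[m/n]*n n d)))

∣∧<⇒≡0 : ∀ {d e} → d ∣ e → e < d → e ≡ 0
∣∧<⇒≡0 {e = zero}  _   _   = refl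
∣∧<⇒≡0 {e = suc _} d∣e e<d = contradiction d∣e (>⇒∤ e<d)

≡-mod⇒≡ : ∀ {m n d} → m < d → n < d → + m ≡ + n [mod d ] → m ≡ n
≡-mod⇒≡ {m} {n} m<d n<d h with ≤-total m n
... | inj₁ m≤n = ≤-antisym m≤n (m∸n≡0⇒m≤n (∣∧<⇒≡0 (≡-mod⇒∣∸ m≤n (≡-mod-sym (+ m) (+ n) h)) (≤-<-trans (m∸n≤m n m) n<d)))
... | inj₂ n≤m = sym (≤-antisym n≤m (m∸n≡0⇒m≤n (∣∧<⇒≡0 (≡-mod⇒∣∸ n≤m h) (≤-<-trans (m∸n≤m m n) m<d))))

module _ {a n d : ℕ} (isOrder : IsOrder a n d) (a⊥n : Coprime a n) .{{_ : NonZero a}} where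
  open IsOrder isOrder

  private instance
    d≢0 : NonZero d
    d≢0 = >-nonZero positive

  coprime-^-divisor : ∀ i {m} → n ∣ a ^ i * m → n ∣ m
  coprime-^-divisor zero    {m} h = subst (n ∣_) (*-identityˡ m) h
  coprime-^-divisor (suc i) {m} h =
    coprime-^-divisor i (coprime-divisor (Coprime.sym a⊥n) (subst (n ∣_) (*-assoc a (a ^ i) m) h))

  ^∸^ : ∀ i j → a ^ (i + j) ∸ a ^ i ≡ a ^ i * (a ^ j ∸ 1)
  ^∸^ i j = begin
    a ^ (i + j) ∸ a ^ i           ≡⟨ cong₂ _∸_ (^-distribˡ-+-* a i j) (sym (*-identityʳ (a ^ i))) ⟩
    a ^ i * a ^ j ∸ a ^ i * 1     ≡⟨ *-distribˡ-∸ (a ^ i) (a ^ j) 1 ⟨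
    a ^ i * (a ^ j ∸ 1)           ∎
    where open ≡-Reasoning

  a^dq≡1 : ∀ q → n ∣ a ^ (q * d) ∸ 1
  a^dq≡1 zero    = n ∣0
  a^dq≡1 (suc q) = subst (n ∣_) eq
    (∣m∣n⇒∣m+n (∣n⇒∣m*n (a ^ d) (a^dq≡1 q)) (≡-mod⇒∣∸ (m^n>0 a d) power≡1))
    where
    open ≡-Reasoning
    eq : a ^ d * (a ^ (q * d) ∸ 1) + (a ^ d ∸ 1) ≡ a ^ (d + q * d) ∸ 1
    eq = begin
      a ^ d * (a ^ (q * d) ∸ 1) + (a ^ d ∸ 1)  ≡⟨ cong (_+ (a ^ d ∸ 1)) (^∸^ d (q * d)) ⟨
      a ^ (d + q * d) ∸ a ^ d + (a ^ d ∸ 1)    ≡⟨ +-∸-assoc _ (m^n>0 a d) ⟨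
      a ^ (d + q * d) ∸ a ^ d + a ^ d ∸ 1      ≡⟨ cong (_∸ 1) (m∸n+n≡m (^-monoʳ-≤ a (m≤m+n d (q * d)))) ⟩
      a ^ (d + q * d) ∸ 1                      ∎

  -- Dividing `e` by `d` leaves a remainder whose power of `a` is again 1 modulo `n`; a positive
  -- remainder would contradict the minimality of `d`.
  a^e≡1⇒d∣e : ∀ e → n ∣ a ^ e ∸ 1 → d ∣ e
  a^e≡1⇒d∣e e h = m%n≡0⇒n∣m e d (small (e % d) (m%n<n e d) remainder)
    where
    open ≡-Reasoning
    small : ∀ r → r < d → n ∣ a ^ r ∸ 1 → r ≡ 0
    small zero    _   _ = refl
    small (suc r) r<d h = contradiction (minimal z<s (∣∸⇒≡-mod (m^n>0 a (suc r)) h)) (<⇒≱ r<d)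

    eq : a ^ e ∸ 1 ≡ a ^ (e / d * d) * (a ^ (e % d) ∸ 1) + (a ^ (e / d * d) ∸ 1)
    eq = begin
      a ^ e ∸ 1
        ≡⟨ cong (λ k → a ^ k ∸ 1) (trans (m≡m%n+[m/n]*n e d) (+-comm (e % d) _)) ⟩
      a ^ (e / d * d + e % d) ∸ 1
        ≡⟨ cong (_∸ 1) (m∸n+n≡m (^-monoʳ-≤ a (m≤m+n (e / d * d) (e % d)))) ⟨
      a ^ (e / d * d + e % d) ∸ a ^ (e / d * d) + a ^ (e / d * d) ∸ 1
        ≡⟨ +-∸-assoc _ (m^n>0 a (e / d * d)) ⟩
      a ^ (e / d * d + e % d) ∸ a ^ (e / d * d) + (a ^ (e / d * d) ∸ 1)
        ≡⟨ cong (_+ (a ^ (e / d * d) ∸ 1)) (^∸^ (e / d * d) (e % d)) ⟩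
      a ^ (e / d * d) * (a ^ (e % d) ∸ 1) + (a ^ (e / d * d) ∸ 1) ∎

    remainder : n ∣ a ^ (e % d) ∸ 1
    remainder = coprime-^-divisor (e / d * d) (∣m+n∣m⇒∣n (subst (n ∣_) (trans eq (+-comm _ (a ^ (e / d * d) ∸ 1))) h) (a^dq≡1 (e / d)))

  -- With the larger exponent written as `i + e`, truncated subtraction of the powers is exact;
  -- arbitrary pairs of exponents reduce to this case by `≤-total`.
  ^-cong-≥ : ∀ i e → d ∣ e → + (a ^ (i + e)) ≡ + (a ^ i) [mod n ]
  ^-cong-≥ i e (divides q refl) = ∣∸⇒≡-mod (^-monoʳ-≤ a (m≤m+n i (q * d)))
    (subst (n ∣_) (sym (^∸^ i (q * d))) (∣n⇒∣m*n (a ^ i) (a^dq≡1 q)))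

  ^-injective-≥ : ∀ i e → + (a ^ (i + e)) ≡ + (a ^ i) [mod n ] → d ∣ e
  ^-injective-≥ i e h = a^e≡1⇒d∣e e (coprime-^-divisor i
    (subst (n ∣_) (^∸^ i e) (≡-mod⇒∣∸ (^-monoʳ-≤ a (m≤m+n i e)) h)))

  ^-cong-mod-order : ∀ i j → + i ≡ + j [mod d ] → + (a ^ i) ≡ + (a ^ j) [mod n ]
  ^-cong-mod-order i j h with ≤-total i j
  ... | inj₁ i≤j with e , refl ← m≤n⇒∃[o]m+o≡n i≤j = ≡-mod-sym (+ (a ^ (i + e))) (+ (a ^ i))
    (^-cong-≥ i e (subst (d ∣_) (m+n∸m≡n i e) (≡-mod⇒∣∸ i≤j (≡-mod-sym (+ i) (+ (i + e)) h))))
  ... | inj₂ j≤i with e , refl ← m≤n⇒∃[o]m+o≡n j≤i =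
    ^-cong-≥ j e (subst (d ∣_) (m+n∸m≡n j e) (≡-mod⇒∣∸ j≤i h))

  ^-injective-mod-order : ∀ i j → + (a ^ i) ≡ + (a ^ j) [mod n ] → + i ≡ + j [mod d ]
  ^-injective-mod-order i j h with ≤-total i j
  ... | inj₁ i≤j with e , refl ← m≤n⇒∃[o]m+o≡n i≤j = ≡-mod-sym (+ (i + e)) (+ i) (∣∸⇒≡-mod i≤j
    (subst (d ∣_) (sym (m+n∸m≡n i e)) (^-injective-≥ i e (≡-mod-sym (+ (a ^ i)) (+ (a ^ (i + e))) h))))
  ... | inj₂ j≤i with e , refl ← m≤n⇒∃[o]m+o≡n j≤i = ∣∸⇒≡-mod j≤i
    (subst (d ∣_) (sym (m+n∸m≡n j e)) (^-injective-≥ j e h))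

prime∤⇒coprime : ∀ {p n} → Prime p → ¬ p ∣ n → Coprime p n
prime∤⇒coprime isPrime p∤n (d∣p , d∣n) with prime⇒irreducible isPrime d∣p
... | inj₁ d≡1  = d≡1
... | inj₂ refl = contradiction d∣n p∤n

-- A common divisor of `m` and `n * o` is coprime to `n` because it divides `m`, hence it divides
-- `o`.
coprime-*ʳ : ∀ {m n o} → Coprime m n → Coprime m o → Coprime m (n * o)
coprime-*ʳ m⊥n m⊥o (d∣m , d∣n*o) =
  m⊥o (d∣m , coprime-divisor (λ (e∣d , e∣n) → m⊥n (∣-trans e∣d d∣m , e∣n)) d∣n*o)

coprime-sq : ∀ {m n} → Coprime m n → Coprime (m * m) (n * n)
coprime-sq m⊥n = Coprime.sym (coprime-*ʳ n²⊥m n²⊥m)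
  where n²⊥m = Coprime.sym (coprime-*ʳ m⊥n m⊥n)

odd⇒2⊥sq : ∀ {n} → Odd n → Coprime 2 (n * n)
odd⇒2⊥sq odd = coprime-*ʳ 2⊥n 2⊥n
  where 2⊥n = prime∤⇒coprime prime[2] odd

distinct-primes⇒coprime : ∀ {p q} → Prime p → Prime q → p ≢ q → Coprime p q
distinct-primes⇒coprime {p} pPrime qPrime p≢q = prime∤⇒coprime pPrime λ p∣q →
  [ (λ { refl → ¬prime[1] pPrime }) , p≢q ]′ (prime⇒irreducible qPrime p∣q)

prime⇒sq≢0 : ∀ {p} → Prime p → NonZero (p * p)
prime⇒sq≢0 {p} isPrime = m*n≢0 p p
  where instance _ = prime⇒nonZero isPrime

-- Any coprimality proof will do here: the value computed by order does not depend on it.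
ω-isOrder : ∀ p (oddPrime : OddPrime p) → IsOrder 2 (p * p) (ω p oddPrime)
ω-isOrder p (isPrime , odd) = proj₂ (order 2 (p * p) {{prime⇒sq≢0 isPrime}} (odd⇒2⊥sq odd))

i≡i%ℕd : ∀ i d .{{_ : NonZero d}} → i ≡ + (i ℤ.%ℕ d) [mod d ]
i≡i%ℕd i d = ≡-mod-intro i _ (i ℤ./ℕ d)
  (trans (cong (ℤ._- + (i ℤ.%ℕ d)) (ℤ.a≡a%ℕn+[a/ℕn]*n i d)) (cancel (+ (i ℤ.%ℕ d)) _))
  where
  cancel : ∀ x y → x ℤ.+ y ℤ.- x ≡ y
  cancel = ℤ.solve-∀

-- The Chinese remainder theorem

∏ : ∀ {m} → (Fin m → ℕ) → ℕ
∏ = foldr _*_ 1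

∣∏ : ∀ {m} (n : Fin m → ℕ) j → n j ∣ ∏ n
∣∏ n zero    = m∣m*n (∏ (n ∘ suc))
∣∏ n (suc j) = ∣n⇒∣m*n (n zero) (∣∏ (n ∘ suc) j)

∏≢0 : ∀ {m} (n : Fin m → ℕ) → (∀ j → NonZero (n j)) → NonZero (∏ n)
∏≢0 {zero}  n n≢0 = _
∏≢0 {suc m} n n≢0 = m*n≢0 (n zero) (∏ (n ∘ suc)) {{n≢0 zero}} {{∏≢0 (n ∘ suc) (n≢0 ∘ suc)}}

coprime-∏ : ∀ {m} k (n : Fin m → ℕ) → (∀ j → Coprime k (n j)) → Coprime k (∏ n)
coprime-∏ {zero}  k n k⊥n = Coprime.sym (Coprime.1-coprimeTo k)
coprime-∏ {suc m} k n k⊥n = coprime-*ʳ (k⊥n zero) (coprime-∏ k (n ∘ suc) (k⊥n ∘ suc))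

coprime⇒inverse : ∀ {m n} → Coprime m n → ∃[ u ] u ℤ.* + m ≡ 1ℤ [mod n ]
coprime⇒inverse {m} {n} m⊥n with coprime-Bézout m⊥n
... | Bézout.+- x y 1+yn≡xm = + x , ≡-mod-intro (+ x ℤ.* + m) 1ℤ (+ y) (begin
  + x ℤ.* + m ℤ.- 1ℤ         ≡⟨ cong (ℤ._- 1ℤ) (ℤ.pos-* x m) ⟨
  + (x * m) ℤ.- 1ℤ           ≡⟨ cong (λ k → + k ℤ.- 1ℤ) 1+yn≡xm ⟨
  1ℤ ℤ.+ + (y * n) ℤ.- 1ℤ    ≡⟨ cong (λ k → 1ℤ ℤ.+ k ℤ.- 1ℤ) (ℤ.pos-* y n) ⟩
  1ℤ ℤ.+ + y ℤ.* + n ℤ.- 1ℤ  ≡⟨ lemma (+ y) (+ n) ⟩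
  + y ℤ.* + n                ∎)
  where
  open ≡-Reasoning
  lemma : ∀ y n → 1ℤ ℤ.+ y ℤ.* n ℤ.- 1ℤ ≡ y ℤ.* n
  lemma = ℤ.solve-∀
... | Bézout.-+ x y 1+xm≡yn = ℤ.- + x , ≡-mod-intro (ℤ.- + x ℤ.* + m) 1ℤ (ℤ.- + y) (begin
  ℤ.- + x ℤ.* + m ℤ.- 1ℤ      ≡⟨ lemma (+ x) (+ m) ⟩
  ℤ.- (1ℤ ℤ.+ + x ℤ.* + m)    ≡⟨ cong (λ k → ℤ.- (1ℤ ℤ.+ k)) (ℤ.pos-* x m) ⟨
  ℤ.- (1ℤ ℤ.+ + (x * m))      ≡⟨ cong (λ k → ℤ.- (+ k)) 1+xm≡yn ⟩
  ℤ.- + (y * n)               ≡⟨ cong ℤ.-_ (ℤ.pos-* y n) ⟩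
  ℤ.- (+ y ℤ.* + n)           ≡⟨ ℤ.neg-distribˡ-* (+ y) (+ n) ⟩
  ℤ.- + y ℤ.* + n             ∎)
  where
  open ≡-Reasoning
  lemma : ∀ x m → ℤ.- x ℤ.* m ℤ.- 1ℤ ≡ ℤ.- (1ℤ ℤ.+ x ℤ.* m)
  lemma = ℤ.solve-∀

-- Induction on the number of moduli: a solution `x` for the tail is corrected by a multiple of the
-- product `N` of the tail moduli, and the inverse `u` of `N` modulo `n zero` makes the correction
-- congruent to `b zero - x` there.
chinese-remainder : ∀ {m} (n : Fin m → ℕ) (b : Fin m → ℤ) →
  (∀ i j → i ≢ j → Coprime (n i) (n j)) → ∃[ x ] ∀ j → x ≡ b j [mod n j ]
chinese-remainder {zero}  n b _   = + 0 , λ ()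
chinese-remainder {suc m} n b n⊥n
  with x , x≡b ← chinese-remainder (n ∘ suc) (b ∘ suc) (λ i j i≢j → n⊥n (suc i) (suc j) (i≢j ∘ Fin.suc-injective))
  with u , uN≡1 ← coprime⇒inverse {∏ (n ∘ suc)} {n zero}
         (Coprime.sym (coprime-∏ (n zero) (n ∘ suc) (λ j → n⊥n zero (suc j) λ ())))
  with v , uN-1≡vn ← ≡-mod-elim (u ℤ.* + ∏ (n ∘ suc)) 1ℤ uN≡1
  = x′ , λ { zero → ≡-mod-intro x′ (b zero) ((b zero ℤ.- x) ℤ.* v) x′-b₀
           ; (suc j) → ≡-mod-trans x′ x (b (suc j)) (∣-trans (∣∏ (n ∘ suc) j) x′≡x) (x≡b j) }
  where
  N = + ∏ (n ∘ suc)
  x′ = x ℤ.+ (b zero ℤ.- x) ℤ.* u ℤ.* N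

  x′≡x : x′ ≡ x [mod ∏ (n ∘ suc) ]
  x′≡x = ≡-mod-intro x′ x ((b zero ℤ.- x) ℤ.* u) (cancel x _)
    where
    cancel : ∀ x y → x ℤ.+ y ℤ.- x ≡ y
    cancel = ℤ.solve-∀

  x′-b₀ : x′ ℤ.- b zero ≡ (b zero ℤ.- x) ℤ.* v ℤ.* + n zero
  x′-b₀ = begin
    x ℤ.+ (b zero ℤ.- x) ℤ.* u ℤ.* N ℤ.- b zero  ≡⟨ factor x (b zero) u N ⟩
    (b zero ℤ.- x) ℤ.* (u ℤ.* N ℤ.- 1ℤ)          ≡⟨ cong ((b zero ℤ.- x) ℤ.*_) uN-1≡vn ⟩
    (b zero ℤ.- x) ℤ.* (v ℤ.* + n zero)          ≡⟨ ℤ.*-assoc (b zero ℤ.- x) v _ ⟨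
    (b zero ℤ.- x) ℤ.* v ℤ.* + n zero            ∎
    where
    open ≡-Reasoning
    factor : ∀ x b u N → x ℤ.+ (b ℤ.- x) ℤ.* u ℤ.* N ℤ.- b ≡ (b ℤ.- x) ℤ.* (u ℤ.* N ℤ.- 1ℤ)
    factor = ℤ.solve-∀

-- A class of exceptions from a covering

module _ {m} (p : Fin m → ℕ) (oddPrime : ∀ j → OddPrime (p j)) (p-distinct : ∀ i j → i ≢ j → p i ≢ p j)
  (d : Fin m → ℕ) (isOrder : ∀ j → IsOrder 2 (p j * p j) (d j)) (a : Fin m → ℤ) (covers : Covers a d) where

  exceptional-class : ∃[ Q ] ∃[ r ] r < Q × ∀ t → Odd (r + t * Q) × ¬ IsSquareFreePlusPowerOf2 (r + t * Q)
  exceptional-class = Q , r , ℤ.n%ℕd<d x Q , λ t → odd t , unrepresentable t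
    where
    -- The extra modulus 2, with residue 1, makes every member of the class odd.
    modulus : Fin (suc m) → ℕ
    modulus zero    = 2
    modulus (suc j) = p j * p j

    modulus≢0 : ∀ j → NonZero (modulus j)
    modulus≢0 zero    = _
    modulus≢0 (suc j) = prime⇒sq≢0 (proj₁ (oddPrime j))

    instance
      d≢0 : ∀ {j} → NonZero (d j)
      d≢0 {j} = >-nonZero (IsOrder.positive (isOrder j))

    -- `a j` may be negative; its least nonnegative residue modulo the order `d j` serves as
    -- exponent instead.
    exponent : Fin m → ℕ
    exponent j = a j ℤ.%ℕ d j

    residue : Fin (suc m) → ℤ
    residue zero    = 1ℤ
    residue (suc j) = + (2 ^ exponent j)

    coprime : ∀ i j → i ≢ j → Coprime (modulus i) (modulus j)
    coprime zero    zero    i≢j = contradiction refl i≢j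
    coprime zero    (suc j) _   = odd⇒2⊥sq (proj₂ (oddPrime j))
    coprime (suc i) zero    _   = Coprime.sym (odd⇒2⊥sq (proj₂ (oddPrime i)))
    coprime (suc i) (suc j) i≢j = coprime-sq (distinct-primes⇒coprime
      (proj₁ (oddPrime i)) (proj₁ (oddPrime j)) (p-distinct i j (i≢j ∘ cong suc)))

    x   = proj₁ (chinese-remainder modulus residue coprime)
    x≡b = proj₂ (chinese-remainder modulus residue coprime)
    Q   = ∏ modulus

    instance
      Q≢0 : NonZero Q
      Q≢0 = ∏≢0 modulus modulus≢0

    r = x ℤ.%ℕ Q

    r+tQ≡b : ∀ t j → + (r + t * Q) ≡ residue j [mod modulus j ]
    r+tQ≡b t j = ≡-mod-trans (+ (r + t * Q)) x (residue j)
      (∣-trans (∣∏ modulus j) (≡-mod-trans (+ (r + t * Q)) (+ r) x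
        (∣∸⇒≡-mod (m≤m+n r (t * Q)) (subst (Q ∣_) (sym (m+n∸m≡n r (t * Q))) (n∣m*n t)))
        (≡-mod-sym x (+ r) (i≡i%ℕd x Q))))
      (x≡b j)

    odd : ∀ t → Odd (r + t * Q)
    odd t 2∣n = contradiction (∣1⇒≡1 2∣1) λ ()
      where
      2∣1 : 2 ∣ 1
      2∣1 = ≡-mod-trans 1ℤ (+ (r + t * Q)) (+ 0) (≡-mod-sym (+ (r + t * Q)) 1ℤ (r+tQ≡b t zero))
              (∣∸⇒≡-mod z≤n 2∣n)

    unrepresentable : ∀ t → ¬ IsSquareFreePlusPowerOf2 (r + t * Q)
    unrepresentable t (s , k , (_ , squareFree) , n≡s+2^k) with j , k≡a ← covers (+ k) =
      squareFree (p j) (proj₁ (oddPrime j))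
        (subst (p j * p j ∣_) (m+n∸n≡m s (2 ^ k)) (≡-mod⇒∣∸ (m≤n+m (2 ^ k) s) n≡2^k))
      where
      2^k≡b : + (2 ^ k) ≡ residue (suc j) [mod p j * p j ]
      2^k≡b = ^-cong-mod-order (isOrder j) (odd⇒2⊥sq (proj₂ (oddPrime j))) k (exponent j)
        (≡-mod-trans (+ k) (a j) (+ exponent j) k≡a (i≡i%ℕd (a j) _))

      n≡2^k : + (s + 2 ^ k) ≡ + (2 ^ k) [mod p j * p j ]
      n≡2^k = subst (λ n → + n ≡ + (2 ^ k) [mod p j * p j ]) n≡s+2^k
        (≡-mod-trans (+ (r + t * Q)) (residue (suc j)) (+ (2 ^ k)) (r+tQ≡b t (suc j))
          (≡-mod-sym (+ (2 ^ k)) (residue (suc j)) 2^k≡b))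

covering⇒exceptional-class : CoveringByOrders →
  ∃[ Q ] ∃[ r ] r < Q × ∀ t → Odd (r + t * Q) × ¬ IsSquareFreePlusPowerOf2 (r + t * Q)
covering⇒exceptional-class (m , _ , p , oddPrime , p-distinct , a , covers) =
  exceptional-class p oddPrime p-distinct (λ j → ω (p j) (oddPrime j)) (λ j → ω-isOrder (p j) (oddPrime j)) a covers

-- Counting exceptions

module _ {A : Set} where

  unique⇒lookup-injective : ∀ {xs : List A} → Unique xs → ∀ i j → lookup xs i ≡ lookup xs j → i ≡ j
  unique⇒lookup-injective (_ ∷ _)    zero    zero    _  = refl
  unique⇒lookup-injective (x∉xs ∷ _) zero    (suc j) eq = contradiction eq (All.lookup x∉xs (∈-lookup j))
  unique⇒lookup-injective (x∉xs ∷ _) (suc i) zero    eq = contradiction (sym eq) (All.lookup x∉xs (∈-lookup i))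
  unique⇒lookup-injective (_ ∷ xs!)  (suc i) (suc j) eq = cong suc (unique⇒lookup-injective xs! i j eq)

  -- `f` receives the membership proof, so that a code may depend on the position of an element or
  -- on a bound known only for members of the list.
  injective⇒length≤ : ∀ {xs : List A} {b} → Unique xs → (f : ∀ {x} → x ∈ xs → Fin b) →
    (∀ {x y} (x∈xs : x ∈ xs) (y∈xs : y ∈ xs) → f x∈xs ≡ f y∈xs → x ≡ y) → length xs ≤ b
  injective⇒length≤ xs! f f-injective = Fin.injective⇒≤ {f = λ i → f (∈-lookup i)} λ {i} {j} eq →
    unique⇒lookup-injective xs! i j (f-injective (∈-lookup i) (∈-lookup j) eq)

  unique∧⊆⇒length≤ : ∀ {xs ys : List A} → Unique xs → xs ⊆ ys → length xs ≤ length ys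
  unique∧⊆⇒length≤ {ys = ys} xs! xs⊆ys = injective⇒length≤ xs! (λ x∈xs → Any.index (xs⊆ys x∈xs)) λ x∈xs y∈xs eq →
    trans (lookup-index (xs⊆ys x∈xs)) (trans (cong (lookup ys) eq) (sym (lookup-index (xs⊆ys y∈xs))))

-- `ε` enters through any fraction equal to it, which serves both a normalised rational and one
-- built by `fromℚᵘ`, whose normal form is not visible.
≤-scaled⇔ : ∀ ε {a b} → toℚᵘ ε ≃ mkℚᵘ (+ a) b → ∀ m n →
  (+ m ℚ./ 1 ℚ.≤ ε ℚ.* (+ n ℚ./ 1)) ⇔ m * suc b ≤ a * n
≤-scaled⇔ ε {a} {b} ε≃a/b m n = mk⇔ to from
  where
  lhs≃ : toℚᵘ (+ m ℚ./ 1) ≃ mkℚᵘ (+ m) 0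
  lhs≃ = ℚ.toℚᵘ-fromℚᵘ (mkℚᵘ (+ m) 0)

  rhs≃ : toℚᵘ (ε ℚ.* (+ n ℚ./ 1)) ≃ mkℚᵘ (+ a) b ℚᵘ.* mkℚᵘ (+ n) 0
  rhs≃ = ℚᵘ.≃-trans (ℚ.toℚᵘ-homo-* ε (+ n ℚ./ 1)) (ℚᵘ.*-cong ε≃a/b (ℚ.toℚᵘ-fromℚᵘ (mkℚᵘ (+ n) 0)))

  left : + (m * suc b) ≡ + m ℤ.* + (suc b * 1)
  left = trans (ℤ.pos-* m (suc b)) (cong (λ k → + m ℤ.* + k) (sym (*-identityʳ (suc b))))

  right : + (a * n) ≡ + a ℤ.* + n ℤ.* + 1
  right = trans (ℤ.pos-* a n) (sym (ℤ.*-identityʳ _))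

  to : + m ℚ./ 1 ℚ.≤ ε ℚ.* (+ n ℚ./ 1) → m * suc b ≤ a * n
  to h = ℤ.drop‿+≤+ (subst₂ ℤ._≤_ (sym left) (sym right)
    (ℚᵘ.drop-*≤* (ℚᵘ.≤-respˡ-≃ lhs≃ (ℚᵘ.≤-respʳ-≃ rhs≃ (ℚ.toℚᵘ-mono-≤ h)))))

  from : m * suc b ≤ a * n → + m ℚ./ 1 ℚ.≤ ε ℚ.* (+ n ℚ./ 1)
  from h = ℚ.toℚᵘ-cancel-≤ (ℚᵘ.≤-respˡ-≃ (ℚᵘ.≃-sym lhs≃) (ℚᵘ.≤-respʳ-≃ (ℚᵘ.≃-sym rhs≃)
    (ℚᵘ.*≤* (subst₂ ℤ._≤_ left right (ℤ.+≤+ h)))))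

module _ {P : Pred ℕ 0ℓ} (P? : Decidable P) where

  almostAllOdd-intro : (∀ c → ∃[ N ] ∀ X → N ≤ X → length (oddExceptions P? X) * suc c ≤ X) → AlmostAllOdd P?
  almostAllOdd-intro h ε@(mkℚ (+ 0)     _ _) 0<ε with ℚ.positive 0<ε
  ... | ()
  almostAllOdd-intro h ε@(mkℚ ℤ.-[1+ _ ] _ _) 0<ε with ℚ.positive 0<ε
  ... | ()
  -- Here ε = (a + 1)/(b + 1) is at least 1/(b + 1), so the bound for `c = b` is enough.
  almostAllOdd-intro h ε@(mkℚ +[1+ a ] b _) _ with N , bound ← h b =
    N , λ X N≤X → Equivalence.from (≤-scaled⇔ ε ℚᵘ.≃-refl (length (oddExceptions P? X)) X) (≤-trans (bound X N≤X) (m≤n*m X (suc a)))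

  almostAllOdd-elim : AlmostAllOdd P? → ∀ c → ∃[ N ] ∀ X → N ≤ X → length (oddExceptions P? X) * suc c ≤ X
  almostAllOdd-elim h c with N , bound ← h (fromℚᵘ (mkℚᵘ (+ 1) c))
      (ℚ.toℚᵘ-cancel-< (ℚᵘ.<-respʳ-≃ (ℚᵘ.≃-sym (ℚ.toℚᵘ-fromℚᵘ (mkℚᵘ (+ 1) c))) (ℚᵘ.positive⁻¹ (mkℚᵘ (+ 1) c)))) =
    N , λ X N≤X → ≤-trans
      (Equivalence.to (≤-scaled⇔ (fromℚᵘ (mkℚᵘ (+ 1) c)) (ℚ.toℚᵘ-fromℚᵘ (mkℚᵘ (+ 1) c)) (length (oddExceptions P? X)) X) (bound X N≤X))
      (≤-reflexive (+-identityʳ X))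

  -- The class has N + 1 members up to X = (N + 1) Q, while the density bound for ε = 1/(Q + 1)
  -- would give (N + 1)(Q + 1) ≤ (N + 1) Q.
  exceptional-class⇒¬almostAllOdd : ∀ {Q r} → r < Q → (∀ t → Odd (r + t * Q) × ¬ P (r + t * Q)) → ¬ AlmostAllOdd P?
  exceptional-class⇒¬almostAllOdd {Q@(suc _)} {r} r<Q exceptional almostAll
    with N , bound ← almostAllOdd-elim almostAll Q =
    <⇒≱ (*-monoʳ-< (suc N) (n<1+n Q)) (≤-trans
      (*-monoˡ-≤ (suc Q) (subst (_≤ length (oddExceptions P? X)) (length-applyUpTo term (suc N))
        (unique∧⊆⇒length≤ (Unique.applyUpTo⁺₁ term (suc N) term-distinct) term∈)))
      (bound X (≤-trans (n≤1+n N) (m≤m*n (suc N) Q))))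
    where
    X = suc N * Q

    term : ℕ → ℕ
    term t = r + t * Q

    term-distinct : ∀ {i j} → i < j → j < suc N → term i ≢ term j
    term-distinct i<j _ = <⇒≢ (+-monoʳ-< r (*-monoˡ-< Q i<j))

    positive : ∀ {n} → Odd n → n ≢ 0
    positive odd refl = odd (2 ∣0)

    term∈ : applyUpTo term (suc N) ⊆ oddExceptions P? X
    term∈ x∈ with t , t<1+N , refl ← ∈-applyUpTo⁻ term x∈ =
      ∈-filter⁺ (λ n → odd? n ×-dec ¬? (P? n)) (∈-1…X (positive (proj₁ (exceptional t))) term≤X) (exceptional t)
      where
      term≤X : term t ≤ X
      term≤X = ≤-trans (+-monoˡ-≤ (t * Q) (<⇒≤ r<Q)) (*-monoˡ-≤ Q t<1+N)

      ∈-1…X : ∀ {n} → n ≢ 0 → n ≤ X → n ∈ applyUpTo suc X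
      ∈-1…X {zero}  n≢0 _   = contradiction refl n≢0
      ∈-1…X {suc n} _   n<X = ∈-applyUpTo⁺ suc n<X

-- Exponents avoiding the squares of small primes

≡-mod? : ∀ x y n → Dec (x ≡ y [mod n ])
≡-mod? x y n = n ∣? ∣ x ℤ.- y ∣

module _ {m} (n d : Fin m → ℕ) (isOrder : ∀ j → IsOrder 2 (n j) (d j)) (2⊥n : ∀ j → Coprime 2 (n j))
  (¬covers : ∀ a → ¬ Covers a d) where

  private
    W = ∏ d

    instance
      W≢0 : NonZero W
      W≢0 = ∏≢0 d (λ j → >-nonZero (IsOrder.positive (isOrder j)))

  -- Otherwise every exponent from 1 to `W` is hit by some `n j`. Exponents hit by the same `n j`
  -- are congruent modulo the order `d j`, so one class per `j` contains them all; as each `d j`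
  -- divides `W`, these classes cover the integers.
  avoiding-exponent : ∀ r → ∃[ k ] 1 ≤ k × k ≤ W × ∀ j → ¬ r ≡ + (2 ^ k) [mod n j ]
  avoiding-exponent r with anyUpTo? (λ k → ¬? (Fin.any? λ j → ≡-mod? r (+ (2 ^ suc k)) (n j))) W
  ... | yes (k , k<W , avoids) = suc k , s≤s z≤n , k<W , λ j r≡ → avoids (j , r≡)
  ... | no ¬avoids = contradiction covers (¬covers a)
    where
    hit? : ∀ j → Dec (∃[ k ] k < W × r ≡ + (2 ^ suc k) [mod n j ])
    hit? j = anyUpTo? (λ k → ≡-mod? r (+ (2 ^ suc k)) (n j)) W

    a : Fin m → ℤ
    a j with hit? j
    ... | yes (k , _) = + suc k
    -- No exponent is hit by this `n j`, so any class will do.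
    ... | no  _       = + 0

    hit : ∀ k → k < W → ∃[ j ] r ≡ + (2 ^ suc k) [mod n j ]
    hit k k<W with Fin.any? (λ j → ≡-mod? r (+ (2 ^ suc k)) (n j))
    ... | yes h = h
    ... | no ¬h = contradiction (k , k<W , ¬h) ¬avoids

    ≡a : ∀ j k → k < W → r ≡ + (2 ^ suc k) [mod n j ] → + suc k ≡ a j [mod d j ]
    ≡a j k k<W r≡ with hit? j
    ... | yes (k′ , _ , r≡′) = ^-injective-mod-order (isOrder j) (2⊥n j) (suc k) (suc k′)
      (≡-mod-trans (+ (2 ^ suc k)) r (+ (2 ^ suc k′)) (≡-mod-sym r (+ (2 ^ suc k)) r≡) r≡′)
    ... | no ¬hit = contradiction (k , k<W , r≡) ¬hit

    covers : Covers a d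
    -- Exponents start at 1, so `x - 1` is reduced modulo `W` and 1 is added back; the
    -- representative of `x` lies between 1 and `W`.
    covers x with j , r≡ ← hit ((x ℤ.- 1ℤ) ℤ.%ℕ W) (ℤ.n%ℕd<d (x ℤ.- 1ℤ) W) = j ,
      ≡-mod-trans x (+ suc k) (a j) (∣-trans (∣∏ d j) x≡1+k) (≡a j k (ℤ.n%ℕd<d (x ℤ.- 1ℤ) W) r≡)
      where
      k = (x ℤ.- 1ℤ) ℤ.%ℕ W

      regroup : ∀ x k → x ℤ.- 1ℤ ℤ.- k ≡ x ℤ.- (1ℤ ℤ.+ k)
      regroup = ℤ.solve-∀

      x≡1+k : x ≡ + suc k [mod W ]
      x≡1+k = subst (λ z → W ∣ ∣ z ∣) (regroup x (+ k)) (i≡i%ℕd (x ℤ.- 1ℤ) W)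

oddPrime? : Decidable OddPrime
oddPrime? p = prime? p ×-dec odd? p

¬covering⇒avoiding-exponent : ¬ CoveringByOrders → ∀ y → 3 ≤ y →
  ∃[ W ] ∀ r → ∃[ k ] 1 ≤ k × k ≤ W × ∀ p → OddPrime p → p ≤ y → ¬ r ≡ + (2 ^ k) [mod p * p ]
¬covering⇒avoiding-exponent ¬covering y 3≤y = ∏ orders , avoid
  where
  primes : List ℕ
  primes = filter oddPrime? (upTo (suc y))

  p : Fin (length primes) → ℕ
  p = lookup primes

  oddPrime : ∀ j → OddPrime (p j)
  oddPrime j = proj₂ (∈-filter⁻ oddPrime? {xs = upTo (suc y)} (∈-lookup j))

  orders : Fin (length primes) → ℕ
  orders j = ω (p j) (oddPrime j)

  ∈primes : ∀ {q} → OddPrime q → q ≤ y → q ∈ primes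
  ∈primes oddPrime-q q≤y = ∈-filter⁺ oddPrime? (∈-upTo⁺ (s≤s q≤y)) oddPrime-q

  p-distinct : ∀ i j → i ≢ j → p i ≢ p j
  p-distinct i j i≢j = i≢j ∘ unique⇒lookup-injective (Unique.filter⁺ oddPrime? (Unique.upTo⁺ (suc y))) i j

  ¬covers : ∀ a → ¬ Covers a orders
  -- The prime 3 makes the list nonempty, as `CoveringByOrders` demands at least one class; this is
  -- where 3 ≤ y enters.
  ¬covers a covers = ¬covering (length primes , ∈-length (∈primes (from-yes (oddPrime? 3)) 3≤y) ,
    p , oddPrime , p-distinct , a , covers)

  avoid : ∀ r → ∃[ k ] 1 ≤ k × k ≤ ∏ orders × ∀ q → OddPrime q → q ≤ y → ¬ r ≡ + (2 ^ k) [mod q * q ]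
  avoid r =
    let k , 1≤k , k≤W , avoids = avoiding-exponent (λ j → p j * p j) orders
          (λ j → ω-isOrder (p j) (oddPrime j)) (λ j → odd⇒2⊥sq (proj₂ (oddPrime j))) ¬covers r
    in k , 1≤k , k≤W , λ q oddPrime-q q≤y →
      let q∈ = ∈primes oddPrime-q q≤y in
      subst (λ q → ¬ r ≡ + (2 ^ k) [mod q * q ]) (sym (lookup-index q∈)) (avoids (Any.index q∈))

-- Squares of large primes

-- The difference is a multiple `q * m`, and `n`, being coprime to `m`, divides `q`.
≡-mod-* : ∀ {x y m n} → Coprime m n → x ≡ y [mod m ] → x ≡ y [mod n ] → x ≡ y [mod m * n ]
≡-mod-* {n = n} m⊥n (divides q eq) n∣ with divides q′ refl ← coprime-divisor (Coprime.sym m⊥n) (subst (n ∣_) (trans eq (*-comm q _)) n∣)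
  = divides q′ (trans eq (trans (*-assoc q′ n _) (cong (q′ *_) (*-comm n _))))

-- A solution of the congruence is determined by its residue modulo M together
-- with the block of length M * D containing it.
length-solutions≤ : ∀ M D .{{_ : NonZero M}} .{{_ : NonZero D}} → Coprime M D → (g : ℕ → ℕ) →
  ∀ {X xs} → Unique xs → (∀ {n} → n ∈ xs → n ≤ X × + n ≡ + g (n % M) [mod D ]) → length xs ≤ M + X / D
length-solutions≤ M D M⊥D g {X} {xs} xs! solutions = begin
  length xs                ≤⟨ injective⇒length≤ xs! code code-injective ⟩
  M * suc (X / (M * D))    ≡⟨ *-suc M _ ⟩
  M + M * (X / (M * D))    ≡⟨ cong (λ k → M + k) (*-comm M _) ⟩
  -- Dividing by `D` first and by `M` afterwards shows that multiplying back by `M` gives at most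
  -- `X / D`.
  M + X / (M * D) * M      ≡⟨ cong (λ q → M + q * M) (trans (/-congʳ (*-comm M D)) (sym (m/n/o≡m/[n*o] X D M))) ⟩
  M + X / D / M * M        ≤⟨ +-monoʳ-≤ M (m/n*n≤m (X / D) M) ⟩
  M + X / D                ∎
  where
  open ≤-Reasoning
  instance
    MD≢0 : NonZero (M * D)
    MD≢0 = m*n≢0 M D
    DM≢0 : NonZero (D * M)
    DM≢0 = m*n≢0 D M

  residue : ∀ n → Fin M
  residue n = fromℕ< (m%n<n n M)

  block : ∀ {n} → n ∈ xs → Fin (suc (X / (M * D)))
  block n∈ = fromℕ< (s≤s (/-monoˡ-≤ (M * D) (proj₁ (solutions n∈))))

  code : ∀ {n} → n ∈ xs → Fin (M * suc (X / (M * D)))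
  code {n} n∈ = combine (residue n) (block n∈)

  code-injective : ∀ {m n} (m∈ : m ∈ xs) (n∈ : n ∈ xs) → code m∈ ≡ code n∈ → m ≡ n
  code-injective {m} {n} m∈ n∈ eq = trans (m≡m%n+[m/n]*n m (M * D))
    (trans (cong₂ (λ r q → r + q * (M * D)) %-eq /-eq) (sym (m≡m%n+[m/n]*n n (M * D))))
    where
    %M-eq : m % M ≡ n % M
    %M-eq = Fin.fromℕ<-injective _ _ _ _ (Fin.combine-injectiveˡ (residue m) (block m∈) (residue n) (block n∈) eq)

    /-eq : m / (M * D) ≡ n / (M * D)
    /-eq = Fin.fromℕ<-injective _ _ _ _ (Fin.combine-injectiveʳ (residue m) (block m∈) (residue n) (block n∈) eq)

    ≡-modM : + m ≡ + n [mod M ]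
    ≡-modM = ≡-mod-trans (+ m) (+ (m % M)) (+ n) (n≡n%d m M)
      (subst (λ r → + r ≡ + n [mod M ]) (sym %M-eq) (≡-mod-sym (+ n) (+ (n % M)) (n≡n%d n M)))

    ≡-modD : + m ≡ + n [mod D ]
    ≡-modD = ≡-mod-trans (+ m) (+ g (m % M)) (+ n) (proj₂ (solutions m∈))
      (subst (λ r → + g r ≡ + n [mod D ]) (sym %M-eq) (≡-mod-sym (+ n) (+ g (n % M)) (proj₂ (solutions n∈))))

    ≡-modMD : + m ≡ + n [mod M * D ]
    ≡-modMD = ≡-mod-* {+ m} {+ n} {M} {D} M⊥D ≡-modM ≡-modD

    %-eq : m % (M * D) ≡ n % (M * D)
    %-eq = ≡-mod⇒≡ (m%n<n m (M * D)) (m%n<n n (M * D))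
      (≡-mod-trans (+ (m % (M * D))) (+ m) (+ (n % (M * D))) (≡-mod-sym (+ m) (+ (m % (M * D))) (n≡n%d m (M * D)))
        (≡-mod-trans (+ m) (+ n) (+ (n % (M * D))) ≡-modMD (n≡n%d n (M * D))))

m∣n! : ∀ {m n} .{{_ : NonZero m}} → m ≤ n → m ∣ n !
m∣n! {suc m} m≤n = ∣-trans (m∣m*n (m !)) (m≤n⇒m!∣n! m≤n)

prime>n⇒∤n! : ∀ {p} → Prime p → ∀ n → n < p → ¬ p ∣ n !
prime>n⇒∤n! pPrime zero    _   p∣1 with refl ← ∣1⇒≡1 p∣1 = ¬prime[1] pPrime
prime>n⇒∤n! pPrime (suc n) n<p p∣n! = [ (λ p∣1+n → <⇒≱ n<p (∣⇒≤ p∣1+n)) , prime>n⇒∤n! pPrime n (<-trans (n<1+n n) n<p) ]′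
  (euclidsLemma (suc n) (n !) pPrime p∣n!)

-- The sum runs over all integers d with y < d ≤ y + R, prime or not; this suffices for an upper
-- bound and lets the sum telescope.
Σ⌊X/d²⌋ : (X y R : ℕ) → ℕ
Σ⌊X/d²⌋ X y zero    = 0
Σ⌊X/d²⌋ X y (suc i) = Σ⌊X/d²⌋ X y i + X / (suc (y + i) * suc (y + i))

-- Σ 1/d² ≤ Σ 1/(d(d-1)) = 1/y - 1/(y+i) over y < d ≤ y+i, cleared of denominators.
Σ⌊X/d²⌋-telescope : ∀ X y .{{_ : NonZero y}} i → y * (y + i) * Σ⌊X/d²⌋ X y i ≤ X * i
Σ⌊X/d²⌋-telescope X y zero    = ≤-reflexive (trans (*-zeroʳ (y * (y + 0))) (sym (*-zeroʳ X)))
Σ⌊X/d²⌋-telescope X y (suc i) = *-cancelˡ-≤ (y + i) {{>-nonZero (≤-trans (>-nonZero⁻¹ y) (m≤m+n y i))}} (begin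
  (y + i) * (y * (y + suc i) * (S + t))
    ≡⟨ expand y i S t ⟩
  suc (y + i) * (y * (y + i) * S) + y * ((y + i) * suc (y + i) * t)
    -- For d = y + i + 1 this replaces (d - 1) d by d², which the next step needs for d² ⌊X/d²⌋ ≤ X.
    ≤⟨ +-mono-≤ (*-monoʳ-≤ (suc (y + i)) (Σ⌊X/d²⌋-telescope X y i))
                (*-monoʳ-≤ y (*-monoˡ-≤ t (*-monoˡ-≤ (suc (y + i)) (n≤1+n (y + i))))) ⟩
  suc (y + i) * (X * i) + y * (D * t)
    ≤⟨ +-monoʳ-≤ _ (*-monoʳ-≤ y (≤-trans (≤-reflexive (*-comm D t)) (m/n*n≤m X D))) ⟩
  suc (y + i) * (X * i) + y * X
    ≡⟨ collect y i X ⟩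
  (y + i) * (X * suc i) ∎)
  where
  open ≤-Reasoning
  D = suc (y + i) * suc (y + i)
  S = Σ⌊X/d²⌋ X y i
  t = X / D
  expand : ∀ y i S t → (y + i) * (y * (y + suc i) * (S + t)) ≡
    suc (y + i) * (y * (y + i) * S) + y * ((y + i) * suc (y + i) * t)
  expand = solve-∀
  collect : ∀ y i X → suc (y + i) * (X * i) + y * X ≡ (y + i) * (X * suc i)
  collect = solve-∀

-- The telescoped bound X R is at most X (y + R), and the factor y + R cancels, which makes the
-- result uniform in `R`.
y*Σ⌊X/d²⌋≤X : ∀ X y .{{_ : NonZero y}} R → y * Σ⌊X/d²⌋ X y R ≤ X
y*Σ⌊X/d²⌋≤X X y R = *-cancelˡ-≤ (y + R) {{>-nonZero (≤-trans (>-nonZero⁻¹ y) (m≤m+n y R))}} (begin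
  (y + R) * (y * Σ⌊X/d²⌋ X y R)  ≡⟨ assoc (y + R) y _ ⟩
  y * (y + R) * Σ⌊X/d²⌋ X y R    ≤⟨ Σ⌊X/d²⌋-telescope X y R ⟩
  X * R                          ≤⟨ *-monoʳ-≤ X (m≤n+m R y) ⟩
  X * (y + R)                    ≡⟨ *-comm X (y + R) ⟩
  (y + R) * X                    ∎)
  where
  open ≤-Reasoning
  assoc : ∀ a b c → a * (b * c) ≡ b * a * c
  assoc = solve-∀

isqrt : ∀ X → ∃[ R ] R * R ≤ X × X < suc R * suc R
isqrt zero    = 0 , z≤n , z<s
isqrt (suc X) with R , R²≤X , X<[1+R]² ← isqrt X with suc X <? suc R * suc R
... | yes 1+X<[1+R]² = R , m≤n⇒m≤1+n R²≤X , 1+X<[1+R]²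
... | no  1+X≮[1+R]² = suc R , ≮⇒≥ 1+X≮[1+R]² , ≤-<-trans X<[1+R]² (*-mono-< (n<1+n (suc R)) (n<1+n (suc R)))

squareFree-or-square-divisor : ∀ n → 0 < n → SquareFree n ⊎ ∃[ p ] Prime p × p * p ∣ n
-- A prime p with p² dividing n satisfies p ≤ p² ≤ n, so a search up to n is exhaustive.
squareFree-or-square-divisor n 0<n with anyUpTo? (λ p → prime? p ×-dec (p * p ∣? n)) (suc n)
... | yes (p , _ , isPrime , p²∣n) = inj₂ (p , isPrime , p²∣n)
... | no none = inj₁ (0<n , λ p isPrime p²∣n →
  let instance
        _ = prime⇒nonZero isPrime
        _ = >-nonZero 0<n
  in none (p , s≤s (≤-trans (m≤m*n p p) (∣⇒≤ p²∣n)) , isPrime , p²∣n))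

-- Bounding the number of exceptions

module _ (y W : ℕ) (exponent : ℕ → ℕ) (1≤exponent : ∀ r → 1 ≤ exponent r) (exponent≤W : ∀ r → exponent r ≤ W)
  (avoids : ∀ r p → OddPrime p → p ≤ y → ¬ + r ≡ + (2 ^ exponent r) [mod p * p ]) where

  private
    -- Every prime p ≤ y has p² dividing `M`, so avoidance for `n % M` passes to `n`; every prime
    -- above `y` is coprime to `M`.
    M : ℕ
    M = y ! * y !

    instance
      M≢0 : NonZero M
      M≢0 = y !* y !≢0

    power : ℕ → ℕ
    power r = 2 ^ exponent r

  -- Since n > 2^W, the difference s = n - 2^k is positive, and it is not squarefree because n is
  -- exceptional. The prime whose square divides s is not 2, by parity, and not an odd prime up to
  -- `y`, by the choice of k.
  exception⇒large-square : ∀ {n} → Odd n → 2 ^ W < n → ¬ IsSquareFreePlusPowerOf2 n →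
    ∃[ p ] Prime p × y < p × p * p ≤ n × + n ≡ + power (n % M) [mod p * p ]
  exception⇒large-square {n} odd 2^W<n ¬representable = large-square (squareFree-or-square-divisor s 0<s)
    where
    k = exponent (n % M)
    s = n ∸ 2 ^ k

    2^k<n : 2 ^ k < n
    2^k<n = ≤-<-trans (^-monoʳ-≤ 2 (exponent≤W (n % M))) 2^W<n

    0<s : 0 < s
    0<s = m<n⇒0<n∸m 2^k<n

    n≡s+2^k : n ≡ s + 2 ^ k
    n≡s+2^k = sym (m∸n+n≡m (<⇒≤ 2^k<n))

    -- Here the exponent must be at least 1: then 2^k is even, and 4 dividing s would make n even.
    4∤s : ¬ 2 * 2 ∣ s
    4∤s 4∣s = odd (subst (2 ∣_) (sym n≡s+2^k) (∣m∣n⇒∣m+n (∣-trans (m∣m*n 2) 4∣s) (2∣2^ (1≤exponent (n % M)))))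
      where
      2∣2^ : ∀ {k} → 1 ≤ k → 2 ∣ 2 ^ k
      2∣2^ {suc k} _ = m∣m*n (2 ^ k)

    large-square : SquareFree s ⊎ ∃[ p ] Prime p × p * p ∣ s →
      ∃[ p ] Prime p × y < p × p * p ≤ n × + n ≡ + power (n % M) [mod p * p ]
    large-square (inj₁ squareFree) = contradiction (s , k , squareFree , n≡s+2^k) ¬representable
    large-square (inj₂ (p , isPrime , p²∣s)) = p , isPrime , ≰⇒> p≰y ,
      ≤-trans (∣⇒≤ {{>-nonZero 0<s}} p²∣s) (m∸n≤m n (2 ^ k)) , n≡2^k
      where
      n≡2^k : + n ≡ + (2 ^ k) [mod p * p ]
      n≡2^k = ∣∸⇒≡-mod (<⇒≤ 2^k<n) p²∣s

      p-odd : Odd p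
      p-odd 2∣p with prime⇒irreducible isPrime 2∣p
      ... | inj₂ refl = 4∤s p²∣s

      p≰y : ¬ p ≤ y
      p≰y p≤y = avoids (n % M) p (isPrime , p-odd) p≤y (≡-mod-trans (+ (n % M)) (+ n) (+ (2 ^ k))
        (∣-trans (*-pres-∣ p∣y! p∣y!) (≡-mod-sym (+ n) (+ (n % M)) (n≡n%d n M))) n≡2^k)
        where p∣y! = m∣n! {{prime⇒nonZero isPrime}} p≤y

  private
    -- Primality is part of the predicate, so that a composite d contributes an empty list and
    -- satisfies the counting bound trivially.
    IsSolution : ℕ → ℕ → Set
    IsSolution d n = Prime d × + n ≡ + power (n % M) [mod d * d ]

    isSolution? : ∀ d → Decidable (IsSolution d)
    isSolution? d n = prime? d ×-dec ≡-mod? (+ n) (+ power (n % M)) (d * d)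

    -- The index `i` stands for d = y + i + 1, as in `Σ⌊X/d²⌋`.
    solutions : ℕ → ℕ → List ℕ
    solutions X i = filter (isSolution? (suc (y + i))) (upTo (suc X))

    solutions! : ∀ X i → Unique (solutions X i)
    solutions! X i = Unique.filter⁺ (isSolution? (suc (y + i))) (Unique.upTo⁺ (suc X))

    ∈-solutions⁻ : ∀ X i {n} → n ∈ solutions X i → n ≤ X × IsSolution (suc (y + i)) n
    ∈-solutions⁻ X i n∈ =
      let n∈upTo , solution = ∈-filter⁻ (isSolution? (suc (y + i))) {xs = upTo (suc X)} n∈
      in s≤s⁻¹ (∈-upTo⁻ n∈upTo) , solution

    length-large-solutions≤ : ∀ X i → Dec (Prime (suc (y + i))) →
      length (solutions X i) ≤ M + X / (suc (y + i) * suc (y + i))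
    length-large-solutions≤ X i (yes isPrime) =
      length-solutions≤ M (d * d) (coprime-sq (Coprime.sym (prime∤⇒coprime isPrime d∤y!))) power (solutions! X i)
        λ n∈ → let n≤X , _ , n≡ = ∈-solutions⁻ X i n∈ in n≤X , n≡
      where
      d = suc (y + i)
      d∤y! = prime>n⇒∤n! isPrime y (s≤s (m≤m+n y i))
    length-large-solutions≤ X i (no ¬prime) = ≤-trans
      (unique∧⊆⇒length≤ {ys = []} (solutions! X i) λ n∈ → contradiction (proj₁ (proj₂ (∈-solutions⁻ X i n∈))) ¬prime)
      z≤n

    length-all-solutions≤ : ∀ X R → length (concat (applyDownFrom (solutions X) R)) ≤ R * M + Σ⌊X/d²⌋ X y R
    length-all-solutions≤ X zero    = z≤n
    length-all-solutions≤ X (suc R) = begin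
      length (solutions X R ++ rest)         ≡⟨ length-++ (solutions X R) ⟩
      length (solutions X R) + length rest   ≤⟨ +-mono-≤ (length-large-solutions≤ X R (prime? (suc (y + R)))) (length-all-solutions≤ X R) ⟩
      M + t + (R * M + Σ⌊X/d²⌋ X y R)        ≡⟨ regroup M t (R * M) (Σ⌊X/d²⌋ X y R) ⟩
      M + R * M + (Σ⌊X/d²⌋ X y R + t)        ∎
      where
      open ≤-Reasoning
      rest = concat (applyDownFrom (solutions X) R)
      t = X / (suc (y + R) * suc (y + R))
      regroup : ∀ a b c d → a + b + (c + d) ≡ a + c + (d + b)
      regroup = solve-∀

    exceptions : ℕ → List ℕ
    exceptions = oddExceptions isSquareFreePlusPowerOf2?

    -- Exceptions up to 2^W are covered by the initial segment. A larger one, n, comes with a prime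
    -- p > y such that p² ≤ n ≤ X < (R + 1)², so p ≤ R, and p = y + 1 + i gives i < R.
    exceptions⊆ : ∀ X R → X < suc R * suc R → exceptions X ⊆ upTo (suc (2 ^ W)) ++ concat (applyDownFrom (solutions X) R)
    exceptions⊆ X R X<[1+R]² {n} n∈
      with n∈1…X , odd , ¬representable ← ∈-filter⁻ (λ n → odd? n ×-dec ¬? (isSquareFreePlusPowerOf2? n)) {xs = applyUpTo suc X} n∈
      with n ≤? 2 ^ W
    ... | yes n≤2^W = ∈-++⁺ˡ (∈-upTo⁺ (s≤s n≤2^W))
    ... | no n≰2^W
      with p , isPrime , y<p , p²≤n , n≡ ← exception⇒large-square odd (≰⇒> n≰2^W) ¬representable
      with i , refl ← m≤n⇒∃[o]m+o≡n y<p =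
      ∈-++⁺ʳ (upTo (suc (2 ^ W))) (∈-concat⁺′ (∈-filter⁺ (isSolution? p) (∈-upTo⁺ (s≤s n≤X)) (isPrime , n≡))
        (∈-applyDownFrom⁺ (solutions X) (≤-trans (s≤s (m≤n+m i y)) p≤R)))
      where
      n≤X : n ≤ X
      n≤X with i , i<X , refl ← ∈-applyUpTo⁻ suc n∈1…X = i<X

      p≤R : p ≤ R
      p≤R = ≮⇒≥ λ R<p → <⇒≱ X<[1+R]² (≤-trans (*-mono-≤ R<p R<p) (≤-trans p²≤n n≤X))

  length-exceptions≤ : ∀ X R → X < suc R * suc R →
    length (oddExceptions isSquareFreePlusPowerOf2? X) ≤ suc (2 ^ W) + (R * (y ! * y !) + Σ⌊X/d²⌋ X y R)
  length-exceptions≤ X R X<[1+R]² = begin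
    length (exceptions X)
      ≤⟨ unique∧⊆⇒length≤ (Unique.filter⁺ (λ n → odd? n ×-dec ¬? (isSquareFreePlusPowerOf2? n))
           (Unique.applyUpTo⁺₁ suc X λ i<j _ → <⇒≢ (s≤s i<j))) (exceptions⊆ X R X<[1+R]²) ⟩
    length (upTo (suc (2 ^ W)) ++ concat (applyDownFrom (solutions X) R))
      ≡⟨ length-++ (upTo (suc (2 ^ W))) ⟩
    length (upTo (suc (2 ^ W))) + length (concat (applyDownFrom (solutions X) R))
      ≤⟨ +-mono-≤ (≤-reflexive (length-upTo (suc (2 ^ W)))) (length-all-solutions≤ X R) ⟩
    suc (2 ^ W) + (R * M + Σ⌊X/d²⌋ X y R) ∎
    where open ≤-Reasoning

-- Choice of parameters and the equivalence

avoiding⇒few-exceptions : ∀ c W →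
  (∀ r → ∃[ k ] 1 ≤ k × k ≤ W × ∀ p → OddPrime p → p ≤ 3 * suc c → ¬ r ≡ + (2 ^ k) [mod p * p ]) →
  ∃[ N ] ∀ X → N ≤ X → length (oddExceptions isSquareFreePlusPowerOf2? X) * suc c ≤ X
-- With y = 3 (c + 1), the product y E is at most y B + K R + y S, and beyond this threshold each of
-- the three terms is at most X.
avoiding⇒few-exceptions c W avoiding = y * B + K * K , few
  where
  y = 3 * suc c
  B = suc (2 ^ W)
  M = y ! * y !
  K = y * M

  few : ∀ X → y * B + K * K ≤ X → length (oddExceptions isSquareFreePlusPowerOf2? X) * suc c ≤ X
  few X N≤X with R , R²≤X , X<[1+R]² ← isqrt X = *-cancelˡ-≤ 3 (begin
    3 * (E * suc c)                      ≡⟨ regroup E (suc c) ⟩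
    y * E                                ≤⟨ *-monoʳ-≤ y E≤ ⟩
    y * (B + (R * M + S))                ≡⟨ distribute y B R M S ⟩
    -- The trailing `0` matches the unfolding of `3 * X` as X + (X + (X + 0)).
    y * B + (K * R + (y * S + 0))        ≤⟨ +-mono-≤ (≤-trans (m≤m+n (y * B) (K * K)) N≤X)
                                              (+-mono-≤ KR≤X (+-monoˡ-≤ 0 (y*Σ⌊X/d²⌋≤X X y R))) ⟩
    3 * X                                ∎)
    where
    open ≤-Reasoning
    E = length (oddExceptions isSquareFreePlusPowerOf2? X)
    S = Σ⌊X/d²⌋ X y R

    E≤ : E ≤ B + (R * M + S)
    E≤ = length-exceptions≤ y W (λ r → proj₁ (avoiding (+ r))) (λ r → proj₁ (proj₂ (avoiding (+ r))))
      (λ r → proj₁ (proj₂ (proj₂ (avoiding (+ r))))) (λ r → proj₂ (proj₂ (proj₂ (avoiding (+ r))))) X R X<[1+R]²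

    KR≤X : K * R ≤ X
    -- If R ≤ K, then K R ≤ K², which the threshold bounds by X; otherwise K R ≤ R² ≤ X.
    KR≤X with ≤-total R K
    ... | inj₁ R≤K = ≤-trans (*-monoʳ-≤ K R≤K) (≤-trans (m≤n+m (K * K) (y * B)) N≤X)
    ... | inj₂ K≤R = ≤-trans (*-monoˡ-≤ R K≤R) R²≤X

    regroup : ∀ a b → 3 * (a * b) ≡ 3 * b * a
    regroup = solve-∀

    distribute : ∀ y B R M S → y * (B + (R * M + S)) ≡ y * B + (y * M * R + (y * S + 0))
    distribute = solve-∀

¬covering⇒almostAllOdd : ¬ CoveringByOrders → AlmostAllOdd isSquareFreePlusPowerOf2?
¬covering⇒almostAllOdd ¬covering = almostAllOdd-intro isSquareFreePlusPowerOf2? λ c →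
  let W , avoiding = ¬covering⇒avoiding-exponent ¬covering (3 * suc c) (*-monoʳ-≤ 3 (s≤s z≤n))
  in avoiding⇒few-exceptions c W avoiding

theorem6p2 : AlmostAllOdd isSquareFreePlusPowerOf2? ⇔ (¬ CoveringByOrders)
theorem6p2 = mk⇔
  (λ almostAll covering → let Q , r , r<Q , exceptional = covering⇒exceptional-class covering in
    exceptional-class⇒¬almostAllOdd isSquareFreePlusPowerOf2? r<Q exceptional almostAll)
  ¬covering⇒almostAllOdd
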